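{- For every closed $\varphi\in\mathrm{cHML}^d$, the synthesised monitor $\mathsf{syn}(\varphi)$ is sound and satisfaction-complete for $\varphi$; that is, for every trace $t\in\mathrm{Trc}$: if $\mathbf{acc}(\mathsf{syn}(\varphi),t)$ then $t\in[\![\varphi]\!]$, and if $t\in[\![\varphi]\!]$ then $\mathbf{acc}(\mathsf{syn}(\varphi),t)$.
   Context: **Data and traces.** Fix a countably infinite set $\mathbb{D}$ (data values) whose only predicate is equality. $\mathrm{Trc}=\mathbb{D}^\omega$; finite traces are elements of $\mathbb{D}^*$. **Logic.** Let $\mathrm{DVar}$, $\mathrm{FVar}$ be countably infinite sets of data variables $x$ and recursion variables $X$; $\star\notin\mathrm{DVar}$ stands for the current data value. Constraint expressions: $b::=\mathsf{true}\mid e=f\mid\neg b\mid b\wedge b$, with $e,f\in\mathrm{DVar}\cup\{\star\}$. $\mathrm{cHML}^d$: $\varphi::=\mathsf{tt}\mid\langle b\rangle\varphi\mid\exists x.\varphi\mid\varphi\vee\varphi\mid\varphi\wedge\varphi\mid\min X.\varphi\mid X$. A data environment $\delta$ is a finite partial function $\mathrm{DVar}\rightharpoonup\mathbb{D}$; data interpretations $F$ map data environments to subsets of $\mathrm{Trc}$ (ordered pointwise by inclusion); trace environments $\rho$ map recursion variables to data interpretations. Semantics: $[\![\mathsf{tt},\rho,\delta]\!]=\mathrm{Trc}$; $[\![X,\rho,\delta]\!]=\rho(X)(\delta)$; $[\![\langle b\rangle\varphi,\rho,\delta]\!]=\{du\mid b\text{ true under }\delta[\star\mapsto d],\ u\in[\![\varphi,\rho,\delta]\!]\}$;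 $[\![\exists x.\varphi,\rho,\delta]\!]=\bigcup_{d\in\mathbb{D}}[\![\varphi,\rho,\delta[x\mapsto d]]\!]$; $\vee,\wedge$ are union, intersection; $[\![\min X.\varphi,\rho,\delta]\!]$ is the value at $\delta$ of the least fixed point of $F\mapsto\lambda\delta'.[\![\varphi,\rho[X\mapsto F],\delta']\!]$. For closed $\varphi$ write $[\![\varphi]\!]$. Standing assumption: each occurrence of a recursion variable is in the scope of a modality inside its defining fixed-point formula. **Monitors.** Syntax: $m::=\mathsf{yes}\mid\mathsf{end}\mid(b).m\mid\mathsf{guess}\,x.m\mid m\oplus m\mid m\otimes m\mid\mathsf{rec}\,X.m\mid X$. Configurations: $c::=(m,\delta)\mid c\odot c$, with $\odot\in\{\oplus,\otimes\}$. Transitions, labelled by $d\in\mathbb{D}$ or by the silent label $\tau$, are those derivable from the following rules ($\odot\in\{\oplus,\otimes\}$): - $(v,\delta)\xrightarrow{d}(v,\delta)$ for $v\in\{\mathsf{yes},\mathsf{end}\}$; - $((b).m,\delta)\xrightarrow{d}(m,\delta)$ if $b$ is true under $\delta[\star\mapsto d]$, and $((b).m,\delta)\xrightarrow{d}(\mathsf{end},\delta)$ if it is false; - $(\mathsf{guess}\,x.m,\delta)\xrightarrow{\tau}(m,\delta[x\mapsto d])$ for any $d\in\mathbb{D}$; - $(\mathsf{rec}\,X.m,\delta)\xrightarrow{\tau}(m[\mathsf{rec}\,X.m/X],\delta)$; - $(m\odot n,\delta)\xrightarrow{\tau}(m,\delta)\odot(n,\delta)$; - if $c_1\xrightarrow{d}c_1'$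 and $c_2\xrightarrow{d}c_2'$ then $c_1\odot c_2\xrightarrow{d}c_1'\odot c_2'$; - if $c_1\xrightarrow{\tau}c_1'$ then $c_1\odot c_2\xrightarrow{\tau}c_1'\odot c_2$; if $c_2\xrightarrow{\tau}c_2'$ then $c_1\odot c_2\xrightarrow{\tau}c_1\odot c_2'$; - $(\mathsf{yes},\delta)\otimes c\xrightarrow{\tau}c$ and $(\mathsf{yes},\delta)\oplus c\xrightarrow{\tau}(\mathsf{yes},\delta)$, and symmetrically with the two components exchanged. Write $c\stackrel{w}{\Longrightarrow}c'$ for $w=d_0\cdots d_l\in\mathbb{D}^*$ if $c'$ is reached from $c$ by a sequence of transitions whose labels, after deleting the $\tau$'s, spell $w$. For $t\in\mathrm{Trc}$, $\mathbf{acc}(m,t)$ holds iff $(m,\varnothing)\stackrel{w}{\Longrightarrow}(\mathsf{yes},\delta')$ for some finite prefix $w$ of $t$ and some $\delta'$. (These monitors never reject.) **Synthesis.** $\mathsf{syn}(\mathsf{tt})=\mathsf{yes}$; $\mathsf{syn}(\exists x.\varphi)=\mathsf{guess}\,x.\mathsf{syn}(\varphi)$; $\mathsf{syn}(\langle b\rangle\varphi)=(b).\mathsf{syn}(\varphi)$; $\mathsf{syn}(\varphi\vee\psi)=\mathsf{syn}(\varphi)\oplus\mathsf{syn}(\psi)$; $\mathsf{syn}(\varphi\wedge\psi)=\mathsf{syn}(\varphi)\otimes\mathsf{syn}(\psi)$; $\mathsf{syn}(\min X.\varphi)=\mathsf{rec}\,X.\mathsf{syn}(\varphi)$; $\mathsf{syn}(X)=X$.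 -}

module Defs where

open import Data.Bool using (if_then_else_)
open import Data.List using (List; []; _∷_; applyUpTo)
open import Data.List.Membership.Propositional using (_∈_)
open import Data.List.Relation.Unary.Any using (here; there)
open import Data.Maybe using (Maybe; just; nothing)
open import Data.Nat using (ℕ; suc)
import Data.Nat.Properties as ℕ
open import Data.Product using (_×_; _,_; ∃)
open import Data.Sum using (_⊎_)
open import Data.Empty using (⊥)
open import Data.Unit.Polymorphic using (⊤)
open import Function using (_∘_; _↔_)
open import Function.Properties.Inverse using (↔⇒↣)
open import Level using (Lift; 0ℓ) renaming (suc to lsuc)
open import Relation.Binary.Definitions using (DecidableEquality)
open import Relation.Binary.PropositionalEquality using (_≡_; _≢_)
open import Relation.Nullary as Dec using (¬_; does)
open import Relation.Nullary.Decidable using (via-injection)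
open import Relation.Unary as Pred using (Pred; _∪_; _∩_)

record Signature : Set₁ where
  field
    𝔻 DVar FVar : Set
    𝔻-countable    : 𝔻 ↔ ℕ
    DVar-countable : DVar ↔ ℕ
    FVar-countable : FVar ↔ ℕ

module cHMLᵈ (S : Signature) where

  open Signature S

  opaque
    _≟ᵈ_ : DecidableEquality DVar
    _≟ᵈ_ = via-injection (↔⇒↣ DVar-countable) ℕ._≟_

    _≟ᶠ_ : DecidableEquality FVar
    _≟ᶠ_ = via-injection (↔⇒↣ FVar-countable) ℕ._≟_

  Trc : Set
  Trc = ℕ → 𝔻

  head : Trc → 𝔻
  head t = t 0

  tail : Trc → Trc
  tail t = t ∘ suc

  update : (DVar → Maybe 𝔻) → DVar → 𝔻 → DVar → Maybe 𝔻
  update f x d y = if does (y ≟ᵈ x) then just d else f y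

  FiniteDomain : (DVar → Maybe 𝔻) → Set
  FiniteDomain f = ∃ λ (xs : List DVar) → ∀ x d → f x ≡ just d → x ∈ xs

  update-finite : ∀ f x d → FiniteDomain f → FiniteDomain (update f x d)
  update-finite f x d (xs , covers) = x ∷ xs , covers′
    where
    covers′ : ∀ y e → update f x d y ≡ just e → y ∈ x ∷ xs
    covers′ y e eq with y ≟ᵈ x
    ... | Dec.yes y≡x = here y≡x
    ... | Dec.no  _   = there (covers y e eq)

  -- The finiteness evidence is irrelevant, so that an environment is
  -- determined by its underlying partial function.
  record DEnv : Set where
    constructor mkDEnv
    field
      lookup  : DVar → Maybe 𝔻
      .finite : FiniteDomain lookup

  open DEnv public using (lookup)

  ∅ : DEnv
  ∅ = mkDEnv (λ _ → nothing) ([] , λ _ _ ())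

  _[_↦_] : DEnv → DVar → 𝔻 → DEnv
  mkDEnv f fin [ x ↦ d ] = mkDEnv (update f x d) (update-finite f x d fin)

  data DTerm : Set where
    var : DVar → DTerm
    ⋆   : DTerm

  infix  8 _≐_
  infixr 6 _∧ᵇ_

  data BExp : Set where
    true : BExp
    _≐_  : DTerm → DTerm → BExp
    ¬ᵇ_  : BExp → BExp
    _∧ᵇ_ : BExp → BExp → BExp

  value : DEnv → 𝔻 → DTerm → Maybe 𝔻
  value δ d (var x) = lookup δ x
  value δ d ⋆       = just d

  -- δ [⋆↦ d ]⊨ b : b is true under δ[⋆ ↦ d]; b is false when it is not true.
  -- An equation with an undefined side counts as false.  This convention does
  -- not affect closed formulas: their meaning at ∅ only depends on evaluating
  -- constraints where all their variables are defined.
  infix 4 _[⋆↦_]⊨_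
  _[⋆↦_]⊨_ : DEnv → 𝔻 → BExp → Set
  δ [⋆↦ d ]⊨ true     = ⊤
  δ [⋆↦ d ]⊨ e ≐ f    = ∃ λ v → value δ d e ≡ just v × value δ d f ≡ just v
  δ [⋆↦ d ]⊨ ¬ᵇ b     = ¬ (δ [⋆↦ d ]⊨ b)
  δ [⋆↦ d ]⊨ b ∧ᵇ b′  = (δ [⋆↦ d ]⊨ b) × (δ [⋆↦ d ]⊨ b′)

  infixr 6 _∧_
  infixr 5 _∨_

  data Form : Set where
    tt      : Form
    ⟨_⟩_    : BExp → Form → Form
    ∃[_]_   : DVar → Form → Form
    _∨_ _∧_ : Form → Form → Form
    min[_]_ : FVar → Form → Form
    rvar    : FVar → Form

  _FreeInTerm_ : DVar → DTerm → Set
  x FreeInTerm var y = x ≡ y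
  x FreeInTerm ⋆     = ⊥

  _FreeInBExp_ : DVar → BExp → Set
  x FreeInBExp true      = ⊥
  x FreeInBExp (e ≐ f)   = x FreeInTerm e ⊎ x FreeInTerm f
  x FreeInBExp (¬ᵇ b)    = x FreeInBExp b
  x FreeInBExp (b ∧ᵇ b′) = x FreeInBExp b ⊎ x FreeInBExp b′

  _DFreeIn_ : DVar → Form → Set
  x DFreeIn tt           = ⊥
  x DFreeIn (⟨ b ⟩ φ)    = x FreeInBExp b ⊎ x DFreeIn φ
  x DFreeIn (∃[ y ] φ)   = x ≢ y × x DFreeIn φ
  x DFreeIn (φ ∨ ψ)      = x DFreeIn φ ⊎ x DFreeIn ψ
  x DFreeIn (φ ∧ ψ)      = x DFreeIn φ ⊎ x DFreeIn ψ
  x DFreeIn (min[ X ] φ) = x DFreeIn φ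
  x DFreeIn (rvar X)     = ⊥

  _RFreeIn_ : FVar → Form → Set
  X RFreeIn tt           = ⊥
  X RFreeIn (⟨ b ⟩ φ)    = X RFreeIn φ
  X RFreeIn (∃[ y ] φ)   = X RFreeIn φ
  X RFreeIn (φ ∨ ψ)      = X RFreeIn φ ⊎ X RFreeIn ψ
  X RFreeIn (φ ∧ ψ)      = X RFreeIn φ ⊎ X RFreeIn ψ
  X RFreeIn (min[ Y ] φ) = X ≢ Y × X RFreeIn φ
  X RFreeIn (rvar Y)     = X ≡ Y

  Closed : Form → Set
  Closed φ = (∀ x → ¬ (x DFreeIn φ)) × (∀ X → ¬ (X RFreeIn φ))

  -- X has a free occurrence that is not in the scope of a modality.
  _ExposedIn_ : FVar → Form → Set
  X ExposedIn tt           = ⊥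
  X ExposedIn (⟨ b ⟩ φ)    = ⊥
  X ExposedIn (∃[ y ] φ)   = X ExposedIn φ
  X ExposedIn (φ ∨ ψ)      = X ExposedIn φ ⊎ X ExposedIn ψ
  X ExposedIn (φ ∧ ψ)      = X ExposedIn φ ⊎ X ExposedIn ψ
  X ExposedIn (min[ Y ] φ) = X ≢ Y × X ExposedIn φ
  X ExposedIn (rvar Y)     = X ≡ Y

  Guarded : Form → Set
  Guarded tt           = ⊤
  Guarded (⟨ b ⟩ φ)    = Guarded φ
  Guarded (∃[ y ] φ)   = Guarded φ
  Guarded (φ ∨ ψ)      = Guarded φ × Guarded ψ
  Guarded (φ ∧ ψ)      = Guarded φ × Guarded ψ
  Guarded (min[ X ] φ) = ¬ (X ExposedIn φ) × Guarded φ
  Guarded (rvar X)     = ⊤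

  DInterp : Set₁
  DInterp = DEnv → Pred Trc 0ℓ

  TEnv : Set₁
  TEnv = FVar → DInterp

  _[_≔_] : TEnv → FVar → DInterp → TEnv
  (ρ [ X ≔ F ]) Y = if does (Y ≟ᶠ X) then F else ρ Y

  -- The least fixed point of a monotone operator, as the intersection of its
  -- prefixed points (Knaster–Tarski).  The intersection ranges over a large
  -- collection, so it lives one universe up; operators therefore take values
  -- there too, which leaves a single level for nested fixed points.
  lfp : (DInterp → DEnv → Pred Trc (lsuc 0ℓ)) → DEnv → Pred Trc (lsuc 0ℓ)
  lfp Φ δ t = (F : DInterp) → (∀ δ′ → Φ F δ′ Pred.⊆ F δ′) → t Pred.∈ F δ

  ⟦_∣_∣_⟧ : Form → TEnv → DEnv → Pred Trc (lsuc 0ℓ)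
  ⟦ tt         ∣ ρ ∣ δ ⟧ = λ _ → ⊤
  ⟦ ⟨ b ⟩ φ    ∣ ρ ∣ δ ⟧ = λ t → (δ [⋆↦ head t ]⊨ b) × tail t Pred.∈ ⟦ φ ∣ ρ ∣ δ ⟧
  ⟦ ∃[ x ] φ   ∣ ρ ∣ δ ⟧ = λ t → ∃ λ d → t Pred.∈ ⟦ φ ∣ ρ ∣ δ [ x ↦ d ] ⟧
  ⟦ φ ∨ ψ      ∣ ρ ∣ δ ⟧ = ⟦ φ ∣ ρ ∣ δ ⟧ ∪ ⟦ ψ ∣ ρ ∣ δ ⟧
  ⟦ φ ∧ ψ      ∣ ρ ∣ δ ⟧ = ⟦ φ ∣ ρ ∣ δ ⟧ ∩ ⟦ ψ ∣ ρ ∣ δ ⟧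
  ⟦ min[ X ] φ ∣ ρ ∣ δ ⟧ = lfp (λ F δ′ → ⟦ φ ∣ ρ [ X ≔ F ] ∣ δ′ ⟧) δ
  ⟦ rvar X     ∣ ρ ∣ δ ⟧ = λ t → Lift (lsuc 0ℓ) (t Pred.∈ ρ X δ)

  -- Meant for closed φ, for which the trace environment is immaterial.
  ⟦_⟧ : Form → Pred Trc (lsuc 0ℓ)
  ⟦ φ ⟧ = ⟦ φ ∣ (λ _ _ → Pred.∅) ∣ ∅ ⟧

  data Op : Set where
    ⊕ ⊗ : Op

  data Mon : Set where
    yes end   : Mon
    ⦅_⦆_      : BExp → Mon → Mon
    guess[_]_ : DVar → Mon → Mon
    _⟨_⟩_     : Mon → Op → Mon → Mon
    rec[_]_   : FVar → Mon → Mon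
    rvar      : FVar → Mon

  -- m [ n / X ].  Recursion variables of n may be captured, so this is meant
  -- for n without free recursion variables, the only case that arises when
  -- running a closed monitor.  Data variables of n are captured on purpose:
  -- like the semantics of a recursion variable, an unfolded monitor uses the
  -- data environment current at the point of unfolding.
  _[_/_] : Mon → Mon → FVar → Mon
  yes           [ n / X ] = yes
  end           [ n / X ] = end
  (⦅ b ⦆ m)     [ n / X ] = ⦅ b ⦆ (m [ n / X ])
  (guess[ x ] m) [ n / X ] = guess[ x ] (m [ n / X ])
  (m ⟨ ⊙ ⟩ m′)  [ n / X ] = (m [ n / X ]) ⟨ ⊙ ⟩ (m′ [ n / X ])
  (rec[ Y ] m)  [ n / X ] = if does (Y ≟ᶠ X) then rec[ Y ] m else rec[ Y ] (m [ n / X ])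
  rvar Y        [ n / X ] = if does (Y ≟ᶠ X) then n else rvar Y

  data Config : Set where
    ⟪_,_⟫ : Mon → DEnv → Config
    _⟨_⟩_ : Config → Op → Config → Config

  data Label : Set where
    act : 𝔻 → Label
    τ   : Label

  infix 3 _—[_]→_

  data _—[_]→_ : Config → Label → Config → Set where
    yes-act : ∀ {δ d} → ⟪ yes , δ ⟫ —[ act d ]→ ⟪ yes , δ ⟫
    end-act : ∀ {δ d} → ⟪ end , δ ⟫ —[ act d ]→ ⟪ end , δ ⟫
    true-act : ∀ {b m δ d} → δ [⋆↦ d ]⊨ b →
      ⟪ ⦅ b ⦆ m , δ ⟫ —[ act d ]→ ⟪ m , δ ⟫
    false-act : ∀ {b m δ d} → ¬ (δ [⋆↦ d ]⊨ b) →
      ⟪ ⦅ b ⦆ m , δ ⟫ —[ act d ]→ ⟪ end , δ ⟫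
    guess-τ : ∀ {x m δ} (d : 𝔻) →
      ⟪ guess[ x ] m , δ ⟫ —[ τ ]→ ⟪ m , δ [ x ↦ d ] ⟫
    rec-τ : ∀ {X m δ} →
      ⟪ rec[ X ] m , δ ⟫ —[ τ ]→ ⟪ m [ rec[ X ] m / X ] , δ ⟫
    fork-τ : ∀ {⊙ m n δ} →
      ⟪ m ⟨ ⊙ ⟩ n , δ ⟫ —[ τ ]→ ⟪ m , δ ⟫ ⟨ ⊙ ⟩ ⟪ n , δ ⟫
    sync-act : ∀ {⊙ c₁ c₁′ c₂ c₂′ d} →
      c₁ —[ act d ]→ c₁′ → c₂ —[ act d ]→ c₂′ →
      c₁ ⟨ ⊙ ⟩ c₂ —[ act d ]→ c₁′ ⟨ ⊙ ⟩ c₂′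
    left-τ : ∀ {⊙ c₁ c₁′ c₂} → c₁ —[ τ ]→ c₁′ →
      c₁ ⟨ ⊙ ⟩ c₂ —[ τ ]→ c₁′ ⟨ ⊙ ⟩ c₂
    right-τ : ∀ {⊙ c₁ c₂ c₂′} → c₂ —[ τ ]→ c₂′ →
      c₁ ⟨ ⊙ ⟩ c₂ —[ τ ]→ c₁ ⟨ ⊙ ⟩ c₂′
    ⊗-yesˡ : ∀ {δ c} → ⟪ yes , δ ⟫ ⟨ ⊗ ⟩ c —[ τ ]→ c
    ⊗-yesʳ : ∀ {δ c} → c ⟨ ⊗ ⟩ ⟪ yes , δ ⟫ —[ τ ]→ c
    ⊕-yesˡ : ∀ {δ c} → ⟪ yes , δ ⟫ ⟨ ⊕ ⟩ c —[ τ ]→ ⟪ yes , δ ⟫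
    ⊕-yesʳ : ∀ {δ c} → c ⟨ ⊕ ⟩ ⟪ yes , δ ⟫ —[ τ ]→ ⟪ yes , δ ⟫

  infix 3 _=[_]⇒_

  data _=[_]⇒_ : Config → List 𝔻 → Config → Set where
    done     : ∀ {c} → c =[ [] ]⇒ c
    τ-step   : ∀ {c c′ c″ w} → c —[ τ ]→ c′ → c′ =[ w ]⇒ c″ → c =[ w ]⇒ c″
    act-step : ∀ {c c′ c″ d w} → c —[ act d ]→ c′ → c′ =[ w ]⇒ c″ → c =[ d ∷ w ]⇒ c″

  prefix : ℕ → Trc → List 𝔻
  prefix n t = applyUpTo t n

  acc : Mon → Trc → Set
  acc m t = ∃ λ n → ∃ λ δ′ → ⟪ m , ∅ ⟫ =[ prefix n t ]⇒ ⟪ yes , δ′ ⟫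

  syn : Form → Mon
  syn tt           = yes
  syn (∃[ x ] φ)   = guess[ x ] syn φ
  syn (⟨ b ⟩ φ)    = ⦅ b ⦆ syn φ
  syn (φ ∨ ψ)      = syn φ ⟨ ⊕ ⟩ syn ψ
  syn (φ ∧ ψ)      = syn φ ⟨ ⊗ ⟩ syn ψ
  syn (min[ X ] φ) = rec[ X ] syn φ
  syn (rvar X)     = rvar X

  Sound : Mon → Form → Set₁
  Sound m φ = ∀ t → acc m t → t Pred.∈ ⟦ φ ⟧

  SatisfactionComplete : Mon → Form → Set₁
  SatisfactionComplete m φ = ∀ t → t Pred.∈ ⟦ φ ⟧ → acc m t

{-# OPTIONS --safe #-}

-- Soundness: reading a monitor back as a formula (with end as a contradiction)
-- and a configuration as a positive combination of such formulas, every
-- transition reflects satisfaction, so an accepting run pulls satisfaction back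
-- from its last configuration.
--
-- Completeness: acceptance is a small predicate, so the least fixed point can be
-- instantiated with acceptance by the unfolded recursion; open formulas are
-- handled by replacing recursion variables by closed monitors.  Guardedness
-- enters only through disjunction: the branch that does not accept must still be
-- able to read the prefix on which the other branch accepts.

module Submission where

open import Defs
open import Data.Bool using (if_then_else_)
open import Data.Empty using (⊥-elim)
open import Data.List using (List; []; _∷_; length)
open import Data.Maybe using (just; nothing)
open import Data.Nat using (ℕ; zero; suc; _≤_; _<_; _⊔_; s≤s)
import Data.Nat.Properties as ℕ
open import Data.Product using (_×_; _,_; proj₁; proj₂; ∃)
open import Data.Sum using (inj₁; inj₂)
open import Function using (_∘_; id; Inverse)
open import Function.Properties.Inverse using (↔⇒↣)
open import Level using (0ℓ; lift) renaming (suc to lsuc)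
open import Relation.Binary.Definitions using (DecidableEquality)
open import Relation.Binary.PropositionalEquality
  using (_≡_; _≢_; refl; sym; trans; cong; cong₂; subst)
open import Relation.Nullary as Dec using (Dec; ¬_; does)
open import Relation.Nullary.Decidable using (via-injection; ¬?; _×-dec_)
open import Relation.Unary as Pred using (Pred; _∈_; _⊆_; _∪_; _∩_)

module Correctness (S : Signature) where

  open Signature S
  open cHMLᵈ S

  -- Decidability of constraints

  _≟_ : DecidableEquality 𝔻
  _≟_ = via-injection (↔⇒↣ 𝔻-countable) ℕ._≟_

  -- Lets `⦅ b ⦆ m` choose constructively between its two transitions when it reads a datum.
  ⊨-dec : ∀ δ d b → Dec (δ [⋆↦ d ]⊨ b)
  ⊨-dec δ d true = Dec.yes _
  ⊨-dec δ d (e ≐ f) with value δ d e | value δ d f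
  ... | nothing | _       = Dec.no λ ()
  ... | just _  | nothing = Dec.no λ ()
  ... | just v  | just v′ with v ≟ v′
  ...   | Dec.yes refl = Dec.yes (v , refl , refl)
  ...   | Dec.no v≢v′  = Dec.no λ { (_ , refl , refl) → v≢v′ refl }
  ⊨-dec δ d (¬ᵇ b)    = ¬? (⊨-dec δ d b)
  ⊨-dec δ d (b ∧ᵇ b′) = ⊨-dec δ d b ×-dec ⊨-dec δ d b′

  exposed⇒free : ∀ φ {X} → X ExposedIn φ → X RFreeIn φ
  exposed⇒free (∃[ _ ] φ)   e         = exposed⇒free φ e
  exposed⇒free (φ ∨ ψ)      (inj₁ e)  = inj₁ (exposed⇒free φ e)
  exposed⇒free (φ ∨ ψ)      (inj₂ e)  = inj₂ (exposed⇒free ψ e)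
  exposed⇒free (φ ∧ ψ)      (inj₁ e)  = inj₁ (exposed⇒free φ e)
  exposed⇒free (φ ∧ ψ)      (inj₂ e)  = inj₂ (exposed⇒free ψ e)
  exposed⇒free (min[ _ ] φ) (X≢Y , e) = X≢Y , exposed⇒free φ e
  exposed⇒free (rvar _)     e         = e

  -- Soundness

  form : Mon → Form
  form yes            = tt
  form end            = ⟨ ¬ᵇ true ⟩ tt
  form (⦅ b ⦆ m)      = ⟨ b ⟩ form m
  form (guess[ x ] m) = ∃[ x ] form m
  form (m ⟨ ⊕ ⟩ n)    = form m ∨ form n
  form (m ⟨ ⊗ ⟩ n)    = form m ∧ form n
  form (rec[ X ] m)   = min[ X ] form m
  form (rvar X)       = rvar X

  form-syn : ∀ φ → form (syn φ) ≡ φ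
  form-syn tt           = refl
  form-syn (⟨ b ⟩ φ)    = cong (⟨ b ⟩_) (form-syn φ)
  form-syn (∃[ x ] φ)   = cong (∃[ x ]_) (form-syn φ)
  form-syn (φ ∨ ψ)      = cong₂ _∨_ (form-syn φ) (form-syn ψ)
  form-syn (φ ∧ ψ)      = cong₂ _∧_ (form-syn φ) (form-syn ψ)
  form-syn (min[ X ] φ) = cong (min[ X ]_) (form-syn φ)
  form-syn (rvar X)     = refl

  RClosed : Mon → Set
  RClosed m = ∀ X → ¬ (X RFreeIn form m)

  -- In the `min` case, every prefixed point for `ρ′` is one for `ρ`. Comparing environments at free
  -- variables alone makes this serve also as a coincidence lemma, for closed formulas and for
  -- shadowed variables.
  ⟦⟧-mono : ∀ φ {ρ ρ′} → (∀ {X} → X RFreeIn φ → ∀ {δ} → ρ X δ ⊆ ρ′ X δ) →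
    ∀ {δ} → ⟦ φ ∣ ρ ∣ δ ⟧ ⊆ ⟦ φ ∣ ρ′ ∣ δ ⟧
  ⟦⟧-mono tt           h s          = s
  ⟦⟧-mono (⟨ b ⟩ φ)    h (b⊨ , s)   = b⊨ , ⟦⟧-mono φ h s
  ⟦⟧-mono (∃[ x ] φ)   h (d , s)    = d , ⟦⟧-mono φ h s
  ⟦⟧-mono (φ ∨ ψ)      h (inj₁ s)   = inj₁ (⟦⟧-mono φ (h ∘ inj₁) s)
  ⟦⟧-mono (φ ∨ ψ)      h (inj₂ s)   = inj₂ (⟦⟧-mono ψ (h ∘ inj₂) s)
  ⟦⟧-mono (φ ∧ ψ)      h (s , s′)   = ⟦⟧-mono φ (h ∘ inj₁) s , ⟦⟧-mono ψ (h ∘ inj₂) s′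
  ⟦⟧-mono (rvar X)     h (lift s)   = lift (h refl s)
  ⟦⟧-mono (min[ X ] φ) {ρ} {ρ′} h s F pre = s F λ δ → pre δ ∘ ⟦⟧-mono φ h′
    where
    h′ : ∀ {Y} → Y RFreeIn φ → ∀ {δ} → (ρ [ X ≔ F ]) Y δ ⊆ (ρ′ [ X ≔ F ]) Y δ
    h′ {Y} Y∈φ with Y ≟ᶠ X
    ... | Dec.yes _  = id
    ... | Dec.no Y≢X = h (Y≢X , Y∈φ)

  -- The semantics of n is a large predicate and cannot be a value of a trace
  -- environment; any small F above it will do.
  ⟦⟧-subst : ∀ m {n X F} → (∀ {ρ δ} → ⟦ form n ∣ ρ ∣ δ ⟧ ⊆ F δ) →
    ∀ {ρ δ} → ⟦ form (m [ n / X ]) ∣ ρ ∣ δ ⟧ ⊆ ⟦ form m ∣ ρ [ X ≔ F ] ∣ δ ⟧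
  ⟦⟧-subst yes            n⊆F s         = s
  ⟦⟧-subst end            n⊆F s         = s
  ⟦⟧-subst (⦅ b ⦆ m)      n⊆F (b⊨ , s)  = b⊨ , ⟦⟧-subst m n⊆F s
  ⟦⟧-subst (guess[ x ] m) n⊆F (d , s)   = d , ⟦⟧-subst m n⊆F s
  ⟦⟧-subst (m ⟨ ⊕ ⟩ m′)   n⊆F (inj₁ s)  = inj₁ (⟦⟧-subst m n⊆F s)
  ⟦⟧-subst (m ⟨ ⊕ ⟩ m′)   n⊆F (inj₂ s)  = inj₂ (⟦⟧-subst m′ n⊆F s)
  ⟦⟧-subst (m ⟨ ⊗ ⟩ m′)   n⊆F (s , s′)  = ⟦⟧-subst m n⊆F s , ⟦⟧-subst m′ n⊆F s′
  ⟦⟧-subst (rvar Y) {X = X} n⊆F s with Y ≟ᶠ X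
  ... | Dec.yes _ = lift (n⊆F s)
  ... | Dec.no _  = s
  ⟦⟧-subst (rec[ Y ] m) {X = X} {F} n⊆F {ρ} s with Y ≟ᶠ X
  -- The substitution stops at a binder of `X`, and there the value that the environment gives to
  -- `X` is shadowed as well.
  ... | Dec.yes refl = ⟦⟧-mono (form (rec[ Y ] m)) shadow {_} s
    where
    shadow : ∀ {Z} → Z RFreeIn form (rec[ Y ] m) → ∀ {δ} → ρ Z δ ⊆ (ρ [ Y ≔ F ]) Z δ
    shadow {Z} (Z≢Y , _) with Z ≟ᶠ Y
    ... | Dec.yes Z≡Y = ⊥-elim (Z≢Y Z≡Y)
    ... | Dec.no _    = id
  -- The bound on `n` holds for every trace environment, so it still applies below the binder; the
  -- two updates then commute because the variables differ.
  ... | Dec.no Y≢X = λ G pre → s G λ δ → pre δ ∘ ⟦⟧-mono (form m) (λ _ → swap G) ∘ ⟦⟧-subst m n⊆F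
    where
    swap : ∀ G {Z δ} → (ρ [ Y ≔ G ] [ X ≔ F ]) Z δ ⊆ (ρ [ X ≔ F ] [ Y ≔ G ]) Z δ
    swap G {Z} with Z ≟ᶠ X | Z ≟ᶠ Y
    ... | Dec.yes refl | Dec.yes refl = ⊥-elim (Y≢X refl)
    ... | Dec.yes _    | Dec.no _     = id
    ... | Dec.no _     | Dec.yes _    = id
    ... | Dec.no _     | Dec.no _     = id

  -- Occurrences of `X` disappear and a closed `n` brings no new ones; hence `rec-τ` preserves
  -- closedness.
  free-subst : ∀ m {n X Y} → RClosed n → Y RFreeIn form (m [ n / X ]) → Y ≢ X × Y RFreeIn form m
  free-subst (⦅ b ⦆ m)      n∅ f = free-subst m n∅ f
  free-subst (guess[ x ] m) n∅ f = free-subst m n∅ f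
  free-subst (m ⟨ ⊕ ⟩ m′)   n∅ (inj₁ f) = let Y≢X , f′ = free-subst m n∅ f in Y≢X , inj₁ f′
  free-subst (m ⟨ ⊕ ⟩ m′)   n∅ (inj₂ f) = let Y≢X , f′ = free-subst m′ n∅ f in Y≢X , inj₂ f′
  free-subst (m ⟨ ⊗ ⟩ m′)   n∅ (inj₁ f) = let Y≢X , f′ = free-subst m n∅ f in Y≢X , inj₁ f′
  free-subst (m ⟨ ⊗ ⟩ m′)   n∅ (inj₂ f) = let Y≢X , f′ = free-subst m′ n∅ f in Y≢X , inj₂ f′
  free-subst (rec[ Z ] m) {X = X} n∅ f with Z ≟ᶠ X
  ... | Dec.yes refl = proj₁ f , f
  ... | Dec.no _     = let Y≢X , f′ = free-subst m n∅ (proj₂ f) in Y≢X , proj₁ f , f′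
  free-subst (rvar Z) {X = X} n∅ f with Z ≟ᶠ X
  ... | Dec.yes _ = ⊥-elim (n∅ _ f)
  ... | Dec.no Z≢X = (λ Y≡X → Z≢X (trans (sym f) Y≡X)) , f

  -- Reflection of satisfaction along transitions

  ρ∅ : TEnv
  ρ∅ _ _ = Pred.∅

  ⟦_⟧ᶜ : Config → Pred Trc (lsuc 0ℓ)
  ⟦ ⟪ m , δ ⟫ ⟧ᶜ   = ⟦ form m ∣ ρ∅ ∣ δ ⟧
  ⟦ c ⟨ ⊕ ⟩ c′ ⟧ᶜ  = ⟦ c ⟧ᶜ ∪ ⟦ c′ ⟧ᶜ
  ⟦ c ⟨ ⊗ ⟩ c′ ⟧ᶜ  = ⟦ c ⟧ᶜ ∩ ⟦ c′ ⟧ᶜ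

  RClosedᶜ : Config → Set
  RClosedᶜ ⟪ m , _ ⟫    = RClosed m
  RClosedᶜ (c ⟨ _ ⟩ c′) = RClosedᶜ c × RClosedᶜ c′

  step-RClosed : ∀ {c ℓ c′} → c —[ ℓ ]→ c′ → RClosedᶜ c → RClosedᶜ c′
  step-RClosed yes-act         c∅ = c∅
  step-RClosed end-act         c∅ = c∅
  step-RClosed (true-act _)    c∅ = c∅
  step-RClosed (false-act _)   c∅ = λ _ ()
  step-RClosed (guess-τ _)     c∅ = c∅
  step-RClosed (rec-τ {m = m}) c∅ = λ X → c∅ X ∘ free-subst m c∅
  step-RClosed (fork-τ {⊕})    c∅ = (λ X → c∅ X ∘ inj₁) , (λ X → c∅ X ∘ inj₂)
  step-RClosed (fork-τ {⊗})    c∅ = (λ X → c∅ X ∘ inj₁) , (λ X → c∅ X ∘ inj₂)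
  step-RClosed (sync-act s s′) (c∅ , c∅′) = step-RClosed s c∅ , step-RClosed s′ c∅′
  step-RClosed (left-τ s)      (c∅ , c∅′) = step-RClosed s c∅ , c∅′
  step-RClosed (right-τ s)     (c∅ , c∅′) = c∅ , step-RClosed s c∅′
  step-RClosed ⊗-yesˡ          (_ , c∅)   = c∅
  step-RClosed ⊗-yesʳ          (c∅ , _)   = c∅
  step-RClosed ⊕-yesˡ          (c∅ , _)   = c∅
  step-RClosed ⊕-yesʳ          (_ , c∅)   = c∅

  τ-reflects : ∀ {c c′} → RClosedᶜ c → c —[ τ ]→ c′ → ⟦ c′ ⟧ᶜ ⊆ ⟦ c ⟧ᶜ
  τ-reflects c∅ (guess-τ d) s = d , s
  τ-reflects c∅ (rec-τ {X} {m} {δ}) s F pre =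
    -- The least fixed point lies below the prefixed point `F`, so `F` may stand for the substituted
    -- recursion. Closedness moves the recursion from an arbitrary trace environment to `ρ∅`, where
    -- `pre` applies.
    pre δ (⟦⟧-subst m (λ {_} {δ′} s′ → ⟦⟧-mono (form (rec[ X ] m)) (⊥-elim ∘ c∅ _) {δ′} s′ F pre) s)
  τ-reflects c∅ (fork-τ {⊕}) s = s
  τ-reflects c∅ (fork-τ {⊗}) s = s
  τ-reflects (c∅ , _) (left-τ {⊕} st)  (inj₁ s) = inj₁ (τ-reflects c∅ st s)
  τ-reflects _        (left-τ {⊕} st)  (inj₂ s) = inj₂ s
  τ-reflects (c∅ , _) (left-τ {⊗} st)  (s , s′) = τ-reflects c∅ st s , s′
  τ-reflects _        (right-τ {⊕} st) (inj₁ s) = inj₁ s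
  τ-reflects (_ , c∅) (right-τ {⊕} st) (inj₂ s) = inj₂ (τ-reflects c∅ st s)
  τ-reflects (_ , c∅) (right-τ {⊗} st) (s , s′) = s , τ-reflects c∅ st s′
  τ-reflects c∅ ⊗-yesˡ s = _ , s
  τ-reflects c∅ ⊗-yesʳ s = s , _
  τ-reflects c∅ ⊕-yesˡ s = inj₁ s
  τ-reflects c∅ ⊕-yesʳ s = inj₂ s

  act-reflects : ∀ {c c′} t → c —[ act (head t) ]→ c′ → tail t ∈ ⟦ c′ ⟧ᶜ → t ∈ ⟦ c ⟧ᶜ
  act-reflects t yes-act       s = s
  act-reflects t end-act       s = s
  act-reflects t (true-act b⊨) s = b⊨ , s
  act-reflects t (false-act _) s = ⊥-elim (proj₁ s _)
  act-reflects t (sync-act {⊕} st st′) (inj₁ s) = inj₁ (act-reflects t st s)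
  act-reflects t (sync-act {⊕} st st′) (inj₂ s) = inj₂ (act-reflects t st′ s)
  act-reflects t (sync-act {⊗} st st′) (s , s′) = act-reflects t st s , act-reflects t st′ s′

  run-sound : ∀ n t {c δ} → RClosedᶜ c → c =[ prefix n t ]⇒ ⟪ yes , δ ⟫ → t ∈ ⟦ c ⟧ᶜ
  run-sound zero    t c∅ done            = _
  run-sound zero    t c∅ (τ-step st r)   = τ-reflects c∅ st (run-sound zero t (step-RClosed st c∅) r)
  run-sound (suc n) t c∅ (τ-step st r)   = τ-reflects c∅ st (run-sound (suc n) t (step-RClosed st c∅) r)
  run-sound (suc n) t c∅ (act-step st r) = act-reflects t st (run-sound n (tail t) (step-RClosed st c∅) r)

  syn-sound : ∀ φ → Closed φ → Sound (syn φ) φ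
  syn-sound φ (_ , φ∅) t (n , _ , r) =
    subst (λ ψ → t ∈ ⟦ ψ ⟧) (form-syn φ)
      (run-sound n t (subst (λ ψ → ∀ X → ¬ (X RFreeIn ψ)) (sym (form-syn φ)) φ∅) r)

  -- Synthesis for open formulas

  MEnv : Set
  MEnv = FVar → Mon

  _[_≔ᵐ_] : MEnv → FVar → Mon → MEnv
  (σ [ X ≔ᵐ m ]) Y = if does (Y ≟ᶠ X) then m else σ Y

  -- All free variables are replaced at once, so that an induction on formulas can enter the body of
  -- a `min` by extending `σ`. A bound variable is sent to itself.
  inst : MEnv → Form → Mon
  inst σ tt           = yes
  inst σ (⟨ b ⟩ φ)    = ⦅ b ⦆ inst σ φ
  inst σ (∃[ x ] φ)   = guess[ x ] inst σ φ
  inst σ (φ ∨ ψ)      = inst σ φ ⟨ ⊕ ⟩ inst σ ψ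
  inst σ (φ ∧ ψ)      = inst σ φ ⟨ ⊗ ⟩ inst σ ψ
  inst σ (min[ X ] φ) = rec[ X ] inst (σ [ X ≔ᵐ rvar X ]) φ
  inst σ (rvar X)     = σ X

  ≔ᵐ-elim : ∀ σ {X m} (P : FVar → Mon → Set) →
    P X m → ∀ {Y} → (Y ≢ X → P Y (σ Y)) → P Y ((σ [ X ≔ᵐ m ]) Y)
  ≔ᵐ-elim σ {X} P p {Y} q with Y ≟ᶠ X
  ... | Dec.yes refl = p
  ... | Dec.no Y≢X   = q Y≢X

  ≔ᵐ-cong : ∀ σ σ′ {X m Y} → (Y ≢ X → σ Y ≡ σ′ Y) → (σ [ X ≔ᵐ m ]) Y ≡ (σ′ [ X ≔ᵐ m ]) Y
  ≔ᵐ-cong σ σ′ {X} {Y = Y} h with Y ≟ᶠ X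
  ... | Dec.yes _  = refl
  ... | Dec.no Y≢X = h Y≢X

  inst-cong : ∀ φ {σ σ′} → (∀ {X} → X RFreeIn φ → σ X ≡ σ′ X) → inst σ φ ≡ inst σ′ φ
  inst-cong tt           h = refl
  inst-cong (⟨ b ⟩ φ)    h = cong (⦅ b ⦆_) (inst-cong φ h)
  inst-cong (∃[ x ] φ)   h = cong (guess[ x ]_) (inst-cong φ h)
  inst-cong (φ ∨ ψ)      h = cong₂ _⟨ ⊕ ⟩_ (inst-cong φ (h ∘ inj₁)) (inst-cong ψ (h ∘ inj₂))
  inst-cong (φ ∧ ψ)      h = cong₂ _⟨ ⊗ ⟩_ (inst-cong φ (h ∘ inj₁)) (inst-cong ψ (h ∘ inj₂))
  inst-cong (min[ X ] φ) {σ} {σ′} h = cong (rec[ X ]_)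
    (inst-cong φ λ Y∈φ → ≔ᵐ-cong σ σ′ λ Y≢X → h (Y≢X , Y∈φ))
  inst-cong (rvar X)     h = h refl

  inst-rvar : ∀ φ → inst rvar φ ≡ syn φ
  inst-rvar tt           = refl
  inst-rvar (⟨ b ⟩ φ)    = cong (⦅ b ⦆_) (inst-rvar φ)
  inst-rvar (∃[ x ] φ)   = cong (guess[ x ]_) (inst-rvar φ)
  inst-rvar (φ ∨ ψ)      = cong₂ _⟨ ⊕ ⟩_ (inst-rvar φ) (inst-rvar ψ)
  inst-rvar (φ ∧ ψ)      = cong₂ _⟨ ⊗ ⟩_ (inst-rvar φ) (inst-rvar ψ)
  inst-rvar (min[ X ] φ) = cong (rec[ X ]_)
    (trans (inst-cong φ λ _ → ≔ᵐ-elim rvar (λ Y m → m ≡ rvar Y) refl λ _ → refl) (inst-rvar φ))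
  inst-rvar (rvar X)     = refl

  -- Unfolding a recursion as an instance of its body

  rvar-subst-≡ : ∀ {X n} → rvar X [ n / X ] ≡ n
  rvar-subst-≡ {X} with X ≟ᶠ X
  ... | Dec.yes _  = refl
  ... | Dec.no X≢X = ⊥-elim (X≢X refl)

  rvar-subst-≢ : ∀ {X Y n} → Y ≢ X → rvar Y [ n / X ] ≡ rvar Y
  rvar-subst-≢ {X} {Y} Y≢X with Y ≟ᶠ X
  ... | Dec.yes Y≡X = ⊥-elim (Y≢X Y≡X)
  ... | Dec.no _    = refl

  -- The second hypothesis covers the occurrences below a rebinding of X, which
  -- the substitution does not reach.
  inst-subst : ∀ φ {σ σ′ n X} →
    (∀ {Y} → Y RFreeIn φ → σ Y [ n / X ] ≡ σ′ Y) →
    (∀ {Y} → Y RFreeIn φ → Y ≢ X → σ Y ≡ σ′ Y) →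
    inst σ φ [ n / X ] ≡ inst σ′ φ
  inst-subst tt         h k = refl
  inst-subst (⟨ b ⟩ φ)  h k = cong (⦅ b ⦆_) (inst-subst φ h k)
  inst-subst (∃[ x ] φ) h k = cong (guess[ x ]_) (inst-subst φ h k)
  inst-subst (φ ∨ ψ)    h k =
    cong₂ _⟨ ⊕ ⟩_ (inst-subst φ (h ∘ inj₁) (k ∘ inj₁)) (inst-subst ψ (h ∘ inj₂) (k ∘ inj₂))
  inst-subst (φ ∧ ψ)    h k =
    cong₂ _⟨ ⊗ ⟩_ (inst-subst φ (h ∘ inj₁) (k ∘ inj₁)) (inst-subst ψ (h ∘ inj₂) (k ∘ inj₂))
  inst-subst (rvar Y)   h k = h refl
  inst-subst (min[ Z ] φ) {σ} {σ′} {n} {X} h k with Z ≟ᶠ X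
  ... | Dec.yes refl = cong (rec[ Z ]_)
          (inst-cong φ λ Y∈φ → ≔ᵐ-cong σ σ′ λ Y≢Z → k (Y≢Z , Y∈φ) Y≢Z)
  ... | Dec.no Z≢X   = cong (rec[ Z ]_)
          (inst-subst φ h′ λ Y∈φ Y≢X → ≔ᵐ-cong σ σ′ λ Y≢Z → k (Y≢Z , Y∈φ) Y≢X)
    where
    h′ : ∀ {Y} → Y RFreeIn φ → (σ [ Z ≔ᵐ rvar Z ]) Y [ n / X ] ≡ (σ′ [ Z ≔ᵐ rvar Z ]) Y
    h′ {Y} Y∈φ with Y ≟ᶠ Z
    ... | Dec.yes _  = rvar-subst-≢ Z≢X
    ... | Dec.no Y≢Z = h (Y≢Z , Y∈φ)

  -- The consequence of closedness on which unfolding relies, stated equationally.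
  Invariant : Mon → Set
  Invariant m = ∀ {n X} → m [ n / X ] ≡ m

  Invariant-on : Form → MEnv → Set
  Invariant-on φ σ = ∀ {X} → X RFreeIn φ → Invariant (σ X)

  unfolded : MEnv → FVar → Form → MEnv
  unfolded σ X φ = σ [ X ≔ᵐ inst σ (min[ X ] φ) ]

  -- Turns the syntactic unfolding of `rec-τ` into an extension of `σ`, so that later inductions
  -- follow the body `φ` and not the growing monitor.
  inst-unfold : ∀ φ {σ X} → Invariant-on (min[ X ] φ) σ →
    inst (σ [ X ≔ᵐ rvar X ]) φ [ inst σ (min[ X ] φ) / X ] ≡ inst (unfolded σ X φ) φ
  inst-unfold φ {σ} {X} σ-inv = inst-subst φ h λ {Y} _ Y≢X → k Y≢X
    where
    h : ∀ {Y} → Y RFreeIn φ →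
      (σ [ X ≔ᵐ rvar X ]) Y [ inst σ (min[ X ] φ) / X ] ≡ unfolded σ X φ Y
    h {Y} Y∈φ with Y ≟ᶠ X
    ... | Dec.yes _  = rvar-subst-≡
    ... | Dec.no Y≢X = σ-inv (Y≢X , Y∈φ)
    k : ∀ {Y} → Y ≢ X → (σ [ X ≔ᵐ rvar X ]) Y ≡ unfolded σ X φ Y
    k {Y} Y≢X with Y ≟ᶠ X
    ... | Dec.yes Y≡X = ⊥-elim (Y≢X Y≡X)
    ... | Dec.no _    = refl

  unfolded-invariant : ∀ φ {σ X} → Invariant-on (min[ X ] φ) σ → Invariant-on φ (unfolded σ X φ)
  unfolded-invariant φ {σ} {X} σ-inv Y∈φ =
    ≔ᵐ-elim σ (λ _ → Invariant) (inst-subst (min[ X ] φ) (λ f → σ-inv f) (λ _ _ → refl))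
      λ Y≢X → σ-inv (Y≢X , Y∈φ)

  unfold-run : ∀ φ {σ X δ w c} → Invariant-on (min[ X ] φ) σ →
    ⟪ inst (unfolded σ X φ) φ , δ ⟫ =[ w ]⇒ c → ⟪ inst σ (min[ X ] φ) , δ ⟫ =[ w ]⇒ c
  unfold-run φ {δ = δ} {w} {c} σ-inv r =
    τ-step rec-τ (subst (λ m → ⟪ m , δ ⟫ =[ w ]⇒ c) (sym (inst-unfold φ σ-inv)) r)

  -- Reading arbitrary words

  -- Quantified over `δ` because guesses change the data environment before a recursion is unfolded
  -- again.
  Reads : Mon → List 𝔻 → Set
  Reads m w = ∀ δ → ∃ λ c → ⟪ m , δ ⟫ =[ w ]⇒ c

  -- The strict bound makes the case `k = 0` vacuous, which starts the induction for recursion.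
  ReadsBelow : ℕ → Mon → Set
  ReadsBelow k m = ∀ {w} → length w < k → Reads m w

  yes-run : ∀ {w δ} → ⟪ yes , δ ⟫ =[ w ]⇒ ⟪ yes , δ ⟫
  yes-run {[]}    = done
  yes-run {_ ∷ _} = act-step yes-act yes-run

  end-run : ∀ {w δ} → ⟪ end , δ ⟫ =[ w ]⇒ ⟪ end , δ ⟫
  end-run {[]}    = done
  end-run {_ ∷ _} = act-step end-act end-run

  -- The silent steps of both sides are scheduled, left before right, until both are ready to read
  -- the next datum together.
  sync-run : ∀ {⊙ c₁ c₁′ c₂ c₂′ w} → c₁ =[ w ]⇒ c₁′ → c₂ =[ w ]⇒ c₂′ →
    c₁ ⟨ ⊙ ⟩ c₂ =[ w ]⇒ c₁′ ⟨ ⊙ ⟩ c₂′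
  sync-run (τ-step st r)     r′                = τ-step (left-τ st) (sync-run r r′)
  sync-run done              done              = done
  sync-run done              (τ-step st r′)    = τ-step (right-τ st) (sync-run done r′)
  sync-run r@(act-step _ _)  (τ-step st r′)    = τ-step (right-τ st) (sync-run r r′)
  sync-run (act-step st r)   (act-step st′ r′) = act-step (sync-act st st′) (sync-run r r′)

  fork-reads : ∀ {⊙ m n w} → Reads m w → Reads n w → Reads (m ⟨ ⊙ ⟩ n) w
  fork-reads r r′ δ = _ , τ-step fork-τ (sync-run (proj₂ (r δ)) (proj₂ (r′ δ)))

  prefixing-reads : ∀ {b m d w} → Reads m w → Reads (⦅ b ⦆ m) (d ∷ w)
  prefixing-reads {b} {d = d} r δ with ⊨-dec δ d b
  ... | Dec.yes b⊨ = _ , act-step (true-act b⊨) (proj₂ (r δ))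
  ... | Dec.no b⊭  = _ , act-step (false-act b⊭) end-run

  -- Lexicographic induction on (k, φ).  A recursion needs itself only below k,
  -- because its variable is not exposed in its body.
  inst-reads : ∀ k φ {σ} → Guarded φ → Invariant-on φ σ →
    (∀ {X} → X RFreeIn φ → ReadsBelow k (σ X)) →
    (∀ {X} → X ExposedIn φ → ReadsBelow (suc k) (σ X)) →
    ReadsBelow (suc k) (inst σ φ)
  inst-reads k tt _ σ-inv free exposed _ δ = _ , yes-run
  inst-reads k (⟨ b ⟩ φ) g σ-inv free exposed {[]} _ δ = _ , done
  inst-reads (suc k) (⟨ b ⟩ φ) g σ-inv free exposed {_ ∷ _} (s≤s w<) =
    -- One datum is consumed and the bound drops by one: what was known of all free variables is now
    -- what the exposed ones require.
    prefixing-reads (inst-reads k φ g σ-inv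
      (λ f → free f ∘ ℕ.m≤n⇒m≤1+n) (free ∘ exposed⇒free φ) w<)
  inst-reads k (∃[ x ] φ) g σ-inv free exposed w< δ =
    _ , τ-step (guess-τ d₀) (proj₂ (inst-reads k φ g σ-inv free exposed w< (δ [ x ↦ d₀ ])))
    where
    -- Any guess will do, since the aim is to read and not to accept; countability provides a datum.
    d₀ : 𝔻
    d₀ = Inverse.from 𝔻-countable 0
  inst-reads k (φ ∨ ψ) (g , g′) σ-inv free exposed w< = fork-reads
    (inst-reads k φ g (λ f → σ-inv (inj₁ f)) (free ∘ inj₁) (exposed ∘ inj₁) w<)
    (inst-reads k ψ g′ (λ f → σ-inv (inj₂ f)) (free ∘ inj₂) (exposed ∘ inj₂) w<)
  inst-reads k (φ ∧ ψ) (g , g′) σ-inv free exposed w< = fork-reads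
    (inst-reads k φ g (λ f → σ-inv (inj₁ f)) (free ∘ inj₁) (exposed ∘ inj₁) w<)
    (inst-reads k ψ g′ (λ f → σ-inv (inj₂ f)) (free ∘ inj₂) (exposed ∘ inj₂) w<)
  inst-reads k (rvar X) g σ-inv free exposed w< = exposed refl w<
  inst-reads k (min[ X ] φ) {σ} (X∉φ , g) σ-inv free exposed {w} w< δ =
    _ , unfold-run φ σ-inv (proj₂ (body δ))
    where
    -- The same formula is revisited, but with the bound lowered by one, so the lexicographic order
    -- decreases.
    self : ∀ j → (∀ {Y} → Y RFreeIn (min[ X ] φ) → ReadsBelow j (σ Y)) →
      ReadsBelow j (inst σ (min[ X ] φ))
    self zero    _     ()
    self (suc j) free′ = inst-reads j (min[ X ] φ) (X∉φ , g) σ-inv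
      (λ f → free′ f ∘ ℕ.m≤n⇒m≤1+n) (free′ ∘ exposed⇒free (min[ X ] φ))
    exposed′ : ∀ {Y} → Y ExposedIn φ → ReadsBelow (suc k) (unfolded σ X φ Y)
    exposed′ {Y} e with Y ≟ᶠ X
    ... | Dec.yes refl = ⊥-elim (X∉φ e)
    ... | Dec.no Y≢X   = exposed (Y≢X , e)
    body : Reads (inst (unfolded σ X φ) φ) w
    body = inst-reads k φ g (unfolded-invariant φ σ-inv)
      (λ Y∈φ → ≔ᵐ-elim σ (λ _ → ReadsBelow k) (self k free) λ Y≢X → free (Y≢X , Y∈φ))
      exposed′ w<

  -- Completeness

  -- Acceptance from an arbitrary data environment is a data interpretation, hence a possible value
  -- of a trace environment; at `∅` it is `acc`.
  Accepts : Mon → DInterp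
  Accepts m δ t = ∃ λ n → ∃ λ δ′ → ⟪ m , δ ⟫ =[ prefix n t ]⇒ ⟪ yes , δ′ ⟫

  -- `yes` reads any further datum, so a verdict can be postponed; this brings both sides of a
  -- conjunction to a common prefix.
  extend-run : ∀ {n n′} t {c δ} → n ≤ n′ →
    c =[ prefix n t ]⇒ ⟪ yes , δ ⟫ → c =[ prefix n′ t ]⇒ ⟪ yes , δ ⟫
  extend-run {zero}  t n≤n′       done            = yes-run
  extend-run {zero}  t n≤n′       (τ-step st r)   = τ-step st (extend-run t n≤n′ r)
  extend-run {suc n} t n≤n′       (τ-step st r)   = τ-step st (extend-run t n≤n′ r)
  extend-run {suc n} t (s≤s n≤n′) (act-step st r) = act-step st (extend-run (tail t) n≤n′ r)

  run-τ : ∀ {c c′ c″ w} → c =[ w ]⇒ c′ → c′ —[ τ ]→ c″ → c =[ w ]⇒ c″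
  run-τ done            st = τ-step st done
  run-τ (τ-step st′ r)  st = τ-step st′ (run-τ r st)
  run-τ (act-step st′ r) st = act-step st′ (run-τ r st)

  accepts-⊕ˡ : ∀ {m n δ t} → (∀ w → Reads n w) → Accepts m δ t → Accepts (m ⟨ ⊕ ⟩ n) δ t
  accepts-⊕ˡ {δ = δ} reads (_ , _ , r) =
    _ , _ , τ-step fork-τ (run-τ (sync-run r (proj₂ (reads _ δ))) ⊕-yesˡ)

  accepts-⊕ʳ : ∀ {m n δ t} → (∀ w → Reads m w) → Accepts n δ t → Accepts (m ⟨ ⊕ ⟩ n) δ t
  accepts-⊕ʳ {δ = δ} reads (_ , _ , r) =
    _ , _ , τ-step fork-τ (run-τ (sync-run (proj₂ (reads _ δ)) r) ⊕-yesʳ)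

  accepts-⊗ : ∀ {m n δ t} → Accepts m δ t → Accepts n δ t → Accepts (m ⟨ ⊗ ⟩ n) δ t
  accepts-⊗ {t = t} (k , _ , r) (l , _ , r′) = k ⊔ l , _ , τ-step fork-τ (run-τ
    (sync-run (extend-run t (ℕ.m≤m⊔n k l) r) (extend-run t (ℕ.m≤n⊔m k l) r′)) ⊗-yesˡ)

  inst-reads-all : ∀ φ {σ} → Guarded φ → Invariant-on φ σ →
    (∀ {X} → X RFreeIn φ → ∀ w → Reads (σ X) w) → ∀ w → Reads (inst σ φ) w
  inst-reads-all φ g σ-inv reads w = inst-reads (length w) φ g σ-inv
    (λ f _ → reads f _) (λ e _ → reads (exposed⇒free φ e) _) ℕ.≤-refl

  -- Induction on `φ` with `ρ` bounded by acceptance under `σ`. Entering a `min` extends both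
  -- environments at `X`, by `Accepts μ` and by `μ`, which keeps the bound.
  inst-complete : ∀ φ {σ ρ} → Guarded φ → Invariant-on φ σ →
    (∀ {X} → X RFreeIn φ → ∀ w → Reads (σ X) w) →
    (∀ {X} → X RFreeIn φ → ∀ {δ} → ρ X δ ⊆ Accepts (σ X) δ) →
    ∀ {δ} → ⟦ φ ∣ ρ ∣ δ ⟧ ⊆ Accepts (inst σ φ) δ
  inst-complete tt _ σ-inv reads acc s = 0 , _ , done
  inst-complete (⟨ b ⟩ φ) g σ-inv reads acc (b⊨ , s) =
    let n , _ , r = inst-complete φ g σ-inv reads acc s in
    suc n , _ , act-step (true-act b⊨) r
  inst-complete (∃[ x ] φ) g σ-inv reads acc (d , s) =
    let _ , _ , r = inst-complete φ g σ-inv reads acc s in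
    _ , _ , τ-step (guess-τ d) r
  inst-complete (φ ∨ ψ) (g , g′) σ-inv reads acc (inj₁ s) = accepts-⊕ˡ
    (inst-reads-all ψ g′ (λ f → σ-inv (inj₂ f)) (reads ∘ inj₂))
    (inst-complete φ g (λ f → σ-inv (inj₁ f)) (reads ∘ inj₁) (λ f → acc (inj₁ f)) s)
  inst-complete (φ ∨ ψ) (g , g′) σ-inv reads acc (inj₂ s) = accepts-⊕ʳ
    (inst-reads-all φ g (λ f → σ-inv (inj₁ f)) (reads ∘ inj₁))
    (inst-complete ψ g′ (λ f → σ-inv (inj₂ f)) (reads ∘ inj₂) (λ f → acc (inj₂ f)) s)
  inst-complete (φ ∧ ψ) (g , g′) σ-inv reads acc (s , s′) = accepts-⊗
    (inst-complete φ g (λ f → σ-inv (inj₁ f)) (reads ∘ inj₁) (λ f → acc (inj₁ f)) s)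
    (inst-complete ψ g′ (λ f → σ-inv (inj₂ f)) (reads ∘ inj₂) (λ f → acc (inj₂ f)) s′)
  inst-complete (rvar X) g σ-inv reads acc (lift s) = acc refl s
  inst-complete (min[ X ] φ) {σ} {ρ} g σ-inv reads acc s = s (Accepts μ) prefixed
    where
    μ : Mon
    μ = inst σ (min[ X ] φ)
    reads′ : ∀ {Y} → Y RFreeIn φ → ∀ w → Reads (unfolded σ X φ Y) w
    reads′ Y∈φ = ≔ᵐ-elim σ (λ _ m → ∀ w → Reads m w)
      (inst-reads-all (min[ X ] φ) g σ-inv reads) λ Y≢X → reads (Y≢X , Y∈φ)
    acc′ : ∀ {Y} → Y RFreeIn φ → ∀ {δ} → (ρ [ X ≔ Accepts μ ]) Y δ ⊆ Accepts (unfolded σ X φ Y) δ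
    acc′ {Y} Y∈φ with Y ≟ᶠ X
    ... | Dec.yes _  = id
    ... | Dec.no Y≢X = acc (Y≢X , Y∈φ)
    -- A trace satisfying the body is accepted by the unfolded body, hence by `μ` after one `rec-τ`.
    prefixed : ∀ δ → ⟦ φ ∣ ρ [ X ≔ Accepts μ ] ∣ δ ⟧ ⊆ Accepts μ δ
    prefixed δ s′ =
      let n , δ′ , r = inst-complete φ (proj₂ g) (unfolded-invariant φ σ-inv) reads′ acc′ s′ in
      n , δ′ , unfold-run φ σ-inv r

  syn-complete : ∀ φ → Closed φ → Guarded φ → SatisfactionComplete (syn φ) φ
  -- With no free recursion variables the conditions on `σ` and `ρ` hold vacuously, so `σ` can be
  -- `rvar`, which yields `syn φ`.
  syn-complete φ (_ , φ∅) g t = subst (λ m → t ∈ Accepts m ∅) (inst-rvar φ) ∘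
    inst-complete φ g (λ {X} f → ⊥-elim (φ∅ X f)) (λ {X} f → ⊥-elim (φ∅ X f)) λ {X} f → ⊥-elim (φ∅ X f)

proposition52 : (S : Signature) → let open cHMLᵈ S in
    (φ : Form) → Closed φ → Guarded φ →
    Sound (syn φ) φ × SatisfactionComplete (syn φ) φ
proposition52 S φ closed guarded = syn-sound φ closed , syn-complete φ closed guarded
  where open Correctness S
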